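{- For every integer $a \ge 2$ and every $b \in \mathbb{N}$, $R_\mathrm{cyc}(C_a^\mathrm{mon}, P_b^\mathrm{mon}) = 1 + (a-1)(b-1)$.
   Context: All graphs are finite, simple and undirected, and a graph of order $n$ has vertex set $\{0,1,\ldots,n-1\}$; $K_n$ is the complete graph on $\{0,\ldots,n-1\}$. A $2$-edge-coloring of $K_n$ assigns each edge a color in $\{1,2\}$. For a graph $H$ and such a coloring, an embedding of $H$ in color $j$ is an injective map $\varphi\colon V(H)\to V(K_n)$ such that for every edge $uv$ of $H$ the edge $\{\varphi(u),\varphi(v)\}$ has color $j$; it is increasing up to a cyclic permutation if there exists $t\in V(H)$ such that $(\varphi(t),\ldots,\varphi(|H|-1),\varphi(0),\ldots,\varphi(t-1))$ is increasing. The cyclic Ramsey number $R_\mathrm{cyc}(H_1,H_2)$ is the smallest $n$ such that every $2$-edge-coloring of $K_n$ admits an embedding of $H_1$ in color $1$ or of $H_2$ in color $2$ that is increasing up to a cyclic permutation. The monotone path $P_n^\mathrm{mon}$ has edges $\{i,i+1\}$, $0\le i\le n-2$. For $n\ge3$ the monotone cycle $C_n^\mathrm{mon}$ is $P_n^\mathrm{mon}$ plus the edge $\{0,n-1\}$; by convention $C_2^\mathrm{mon}=K_2$. -}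

module Defs where

open import Data.Fin.Base using (Fin; toℕ; _<_)
open import Data.List.Base using (List; _++_; drop; take; tabulate)
open import Data.List.Relation.Unary.AllPairs using (AllPairs)
open import Data.Nat.Base using (ℕ; zero; suc; _≤_; s≤s)
open import Data.Nat.Properties using (1+n≢n)
open import Data.Product.Base using (_×_; _,_; ∃-syntax; Σ-syntax)
open import Data.Sum.Base using (_⊎_; inj₁; inj₂)
open import Function.Definitions using (Injective)
open import Level using (0ℓ)
open import Relation.Binary.Core using (Rel)
open import Relation.Binary.Construct.Closure.Symmetric using (SymClosure; fwd; bwd; symmetric)
open import Relation.Binary.Definitions using (Symmetric)
open import Relation.Binary.PropositionalEquality using (_≡_; _≢_; refl; ≢-sym)
open import Relation.Nullary.Negation using (¬_)

record Graph (n : ℕ) : Set₁ where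
  field
    Adj    : Rel (Fin n) 0ℓ
    symm   : Symmetric Adj
    irrefl : ∀ {u} → ¬ Adj u u

open Graph public

-- The simple graph with an edge {u,v} whenever E u v holds.
fromArcs : ∀ {n} (E : Rel (Fin n) 0ℓ) → (∀ {u} → ¬ E u u) → Graph n
fromArcs E irr = record
  { Adj    = SymClosure E
  ; symm   = symmetric E
  ; irrefl = λ { (fwd e) → irr e ; (bwd e) → irr e }
  }

K : (n : ℕ) → Graph n
K n = record { Adj = _≢_ ; symm = ≢-sym ; irrefl = λ u≢u → u≢u refl }

PathArc : ∀ {n} → Rel (Fin n) 0ℓ
PathArc u v = suc (toℕ u) ≡ toℕ v

Pmon : (n : ℕ) → Graph n
Pmon n = fromArcs PathArc 1+n≢n

ClosingArc : ∀ {n} → Rel (Fin n) 0ℓ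
ClosingArc {n} u v = toℕ u ≡ 0 × suc (toℕ v) ≡ n

Cmon : (n : ℕ) → 2 ≤ n → Graph n
Cmon (suc zero)          (s≤s ())
Cmon (suc (suc zero))    _ = K 2
Cmon (suc (suc (suc k))) _ = fromArcs (λ u v → PathArc u v ⊎ ClosingArc u v) irr
  where
  irr : ∀ {u : Fin (suc (suc (suc k)))} → ¬ (PathArc u u ⊎ ClosingArc u u)
  irr         (inj₁ e)        = 1+n≢n e
  irr {u} (inj₂ (u≡0 , e)) rewrite u≡0 with () ← e

data Color : Set where
  color₁ color₂ : Color

-- A coloring of the edges of K n, as a symmetric function of the endpoints.
-- The values on the diagonal are irrelevant: embeddings are injective and
-- graphs have no loops, so these values are never inspected.
record Coloring (n : ℕ) : Set where
  field
    color     : Fin n → Fin n → Color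
    color-sym : ∀ u v → color u v ≡ color v u

open Coloring public

record Embedding {h n} (H : Graph h) (c : Coloring n) (j : Color) : Set where
  field
    φ         : Fin h → Fin n
    injective : Injective _≡_ _≡_ φ
    colored   : ∀ {u v} → Adj H u v → color c (φ u) (φ v) ≡ j

Increasing : ∀ {n} → List (Fin n) → Set
Increasing = AllPairs _<_

-- (φ t , … , φ (h - 1) , φ 0 , … , φ (t - 1))
rotation : ∀ {h n} → (Fin h → Fin n) → Fin h → List (Fin n)
rotation φ t = drop (toℕ t) (tabulate φ) ++ take (toℕ t) (tabulate φ)

IncreasingUpToCyclic : ∀ {h n} → (Fin h → Fin n) → Set
IncreasingUpToCyclic φ = ∃[ t ] Increasing (rotation φ t)

HasCyclicEmbedding : ∀ {h n} → Graph h → Coloring n → Color → Set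
HasCyclicEmbedding H c j =
  Σ[ f ∈ Embedding H c j ] IncreasingUpToCyclic (Embedding.φ f)

CyclicRamsey : ∀ {h₁ h₂} → Graph h₁ → Graph h₂ → ℕ → Set
CyclicRamsey H₁ H₂ n = (c : Coloring n) →
  HasCyclicEmbedding H₁ c color₁ ⊎ HasCyclicEmbedding H₂ c color₂

-- IsRcyc H₁ H₂ N says that the cyclic Ramsey number of H₁ and H₂ is N, i.e.
-- that N is the smallest n with CyclicRamsey H₁ H₂ n.
IsRcyc : ∀ {h₁ h₂} → Graph h₁ → Graph h₂ → ℕ → Set
IsRcyc H₁ H₂ N = CyclicRamsey H₁ H₂ N × (∀ n → CyclicRamsey H₁ H₂ n → N ≤ n)

{-# OPTIONS --safe #-}

-- Upper bound.  Repeatedly remove the vertices having no smaller neighbour of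
-- color 2 among the remaining ones.  Each removed layer is a clique of color 1,
-- and a vertex surviving m removals ends an increasing path of color 2 with
-- m + 1 vertices.  Hence 1 + (a - 1)(b - 1) vertices already force a clique of
-- order a in color 1 or an increasing path of order b in color 2.
--
-- Lower bound.  Split (a - 1)(b - 1) vertices into a - 1 intervals of length
-- b - 1, with color 2 inside the intervals and color 1 between them.  A path of
-- color 2 stays in one interval.  A monotone cycle of color 1, read from its
-- smallest vertex, enters a later interval at each step.
module Submission where

open import Data.Bool.Base using (if_then_else_)
open import Data.Fin.Base as Fin using (Fin; zero; suc; toℕ; fromℕ; inject₁; inject≤; combine; quotient; remainder)
open import Data.Fin.Induction using (<-weakInduction)
open import Data.Fin.Properties as Fin using (_≟_; _<?_; toℕ-fromℕ; toℕ-inject₁; toℕ-inject≤; inject≤-injective; combine-remQuot; combine-monoˡ-<; injective⇒≤)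
open import Data.List.Base using (List; []; _∷_; _++_; allFin; drop; filter; head; last; length; lookup; tabulate; take)
open import Data.List.Membership.Propositional using (_∈_; find; lose)
open import Data.List.Membership.Propositional.Properties using (∈-filter⁻; ∈-lookup)
open import Data.List.Properties using (++-identityʳ; length-++-comm; length-map; length-tabulate; length-take; tabulate-lookup; take++drop≡id)
open import Data.List.Relation.Binary.Sublist.Propositional using (_⊆_; []; _∷_; _∷ʳ_; ⊆-trans) renaming (lookup to ⊆-lookup)
open import Data.List.Relation.Binary.Sublist.Propositional.Properties using (All-resp-⊆; filter-⊆; take-⊆)
import Data.List.Relation.Unary.All as All
open import Data.List.Relation.Unary.AllPairs as AllPairs using (AllPairs; []; _∷_)
open import Data.List.Relation.Unary.AllPairs.Properties using (tabulate⁺-<)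
open import Data.List.Relation.Unary.Any using (Any; here; any?)
open import Data.List.Relation.Unary.Linked as Linked using (Linked; []; [-]; _∷_)
open import Data.List.Relation.Unary.Linked.Properties using (AllPairs⇒Linked; Linked⇒AllPairs; map⁺; ++⁺)
open import Data.List.Relation.Unary.Unique.Propositional using (Unique)
open import Data.Maybe.Base using (just)
open import Data.Maybe.Relation.Binary.Connected using (Connected; just)
open import Data.Nat.Base using (ℕ; zero; suc; _+_; _*_; _∸_; _≤_; _<_; s≤s; s<s⁻¹)
open import Data.Nat.Properties as ℕ using (_≤?_)
open import Data.Product.Base using (_×_; _,_; proj₁; proj₂; ∃-syntax)
open import Data.Sum.Base using (_⊎_; inj₁; inj₂)
open import Function.Base using (id; _∘_)
open import Function.Definitions using (Injective)
open import Level using (Level)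
open import Relation.Binary.Construct.Closure.Symmetric using (fwd; bwd)
open import Relation.Binary.Core using (Rel)
open import Relation.Binary.Definitions using (Decidable; tri<; tri≈; tri>)
open import Relation.Binary.PropositionalEquality using (_≡_; _≢_; refl; sym; trans; cong; cong₂; subst; subst₂)
open import Relation.Nullary.Decidable using (Dec; yes; no; does; ¬?; _×-dec_)
open import Relation.Nullary.Negation using (¬_; contradiction)
open import Relation.Unary as Unary using (Pred)
open import Defs

-- Lists: lookups, linked lists and rotation.

private
  variable
    ℓ r p : Level
    A : Set ℓ
    R : Rel A r
    k m n : ℕ
    xs ys : List A

AllPairs-resp-⊆ : xs ⊆ ys → AllPairs R ys → AllPairs R xs
AllPairs-resp-⊆ []         []         = []
AllPairs-resp-⊆ (_ ∷ʳ τ)   (_ ∷ prs)  = AllPairs-resp-⊆ τ prs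
AllPairs-resp-⊆ (refl ∷ τ) (pr ∷ prs) = All-resp-⊆ τ pr ∷ AllPairs-resp-⊆ τ prs

AllPairs-lookup : AllPairs R xs → ∀ {i j} → i Fin.< j → R (lookup xs i) (lookup xs j)
AllPairs-lookup {xs = _ ∷ xs} (pr ∷ _)  {zero}  {suc j} _   = All.lookup pr (∈-lookup {xs = xs} j)
AllPairs-lookup               (_ ∷ prs) {suc i} {suc j} i<j = AllPairs-lookup prs (s<s⁻¹ i<j)

lookup-injective : Unique xs → Injective _≡_ _≡_ (lookup xs)
lookup-injective u {i} {j} eq with Fin.<-cmp i j
... | tri< i<j _ _ = contradiction eq (AllPairs-lookup u i<j)
... | tri≈ _ i≡j _ = i≡j
... | tri> _ _ j<i = contradiction (sym eq) (AllPairs-lookup u j<i)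

Linked-lookup : Linked R xs → ∀ {i j} → PathArc i j → R (lookup xs i) (lookup xs j)
Linked-lookup (pr ∷ _)  {zero}  {suc zero} _ = pr
Linked-lookup (_ ∷ prs) {suc i} {suc j}    e = Linked-lookup prs (ℕ.suc-injective e)

Linked-tabulate⁺ : (f : Fin n → A) → (∀ {i j} → PathArc i j → R (f i) (f j)) → Linked R (tabulate f)
Linked-tabulate⁺ {n = zero}        f Rf = []
Linked-tabulate⁺ {n = suc zero}    f Rf = [-]
Linked-tabulate⁺ {n = suc (suc _)} f Rf = Rf refl ∷ Linked-tabulate⁺ (f ∘ suc) (Rf ∘ cong suc)

last-tabulate : (f : Fin (suc n) → A) → last (tabulate f) ≡ just (f (fromℕ n))
last-tabulate {n = zero}  f = refl
last-tabulate {n = suc _} f = last-tabulate (f ∘ suc)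

last-++-∷ : (xs : List A) {y : A} {ys : List A} → last (xs ++ y ∷ ys) ≡ last (y ∷ ys)
last-++-∷ []           = refl
last-++-∷ (_ ∷ [])     = refl
last-++-∷ (_ ∷ x ∷ xs) = last-++-∷ (x ∷ xs)

Linked-++⁻ : ∀ xs → Linked R (xs ++ ys) → Linked R xs × Linked R ys
Linked-++⁻ []           prs        = [] , prs
Linked-++⁻ (_ ∷ [])     prs        = [-] , Linked.tail prs
Linked-++⁻ (_ ∷ x ∷ xs) (pr ∷ prs) with pxs , pys ← Linked-++⁻ (x ∷ xs) prs = pr ∷ pxs , pys

-- The only new link joins the last entry of `ys` to the first of `xs`, which are the two ends of
-- the whole list. This is how a closed walk is reread from another starting point.
Linked-++-swap : (xs ys : List A) → Linked R (xs ++ ys) →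
                 Connected R (last (xs ++ ys)) (head (xs ++ ys)) → Linked R (ys ++ xs)
Linked-++-swap {R = R} []       ys       prs c = subst (Linked R) (sym (++-identityʳ ys)) prs
Linked-++-swap {R = R} (x ∷ xs) []       prs c = subst (Linked R) (++-identityʳ (x ∷ xs)) prs
Linked-++-swap {R = R} (x ∷ xs) (y ∷ ys) prs c with pxs , pys ← Linked-++⁻ (x ∷ xs) prs =
  ++⁺ pys (subst (λ z → Connected R z (just x)) (last-++-∷ (x ∷ xs)) c) pxs

length-filter-complement : {P : Pred A p} (P? : Unary.Decidable P) (xs : List A) →
                           length (filter P? xs) + length (filter (¬? ∘ P?) xs) ≡ length xs
length-filter-complement P? [] = refl
length-filter-complement P? (x ∷ xs) with P? x
... | yes _ = cong suc (length-filter-complement P? xs)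
... | no  _ = trans (ℕ.+-suc _ _) (cong suc (length-filter-complement P? xs))

-- Antichains and chains for a decidable relation.

module _ {A : Set ℓ} {R : Rel A r} (R? : Decidable R) where

  private
    hasPred? : (xs : List A) → Unary.Decidable (λ y → Any (λ x → R x y) xs)
    hasPred? xs y = any? (λ x → R? x y) xs

    minimal nonMinimal : List A → List A
    minimal    xs = filter (¬? ∘ hasPred? xs) xs
    nonMinimal xs = filter (hasPred? xs) xs

    minimal-antichain : ∀ xs {x y} → x ∈ minimal xs → y ∈ minimal xs → ¬ R x y
    minimal-antichain xs x∈ y∈ Rxy =
      proj₂ (∈-filter⁻ (¬? ∘ hasPred? xs) {xs = xs} y∈)
        (lose (proj₁ (∈-filter⁻ (¬? ∘ hasPred? xs) {xs = xs} x∈)) Rxy)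

    -- A layer that is too small for the antichain removes at most `k` entries, so the bound drops
    -- by at most one multiple of `k`.
    nonMinimal-large : ∀ k m xs → suc (k * suc m) ≤ length xs → ¬ suc k ≤ length (minimal xs) →
                       suc (k * m) ≤ length (nonMinimal xs)
    nonMinimal-large k m xs large few = ℕ.≰⇒> λ short → ℕ.<⇒≱ large (begin
      length xs                                    ≡⟨ length-filter-complement (hasPred? xs) xs ⟨
      length (nonMinimal xs) + length (minimal xs) ≤⟨ ℕ.+-mono-≤ short (ℕ.≮⇒≥ few) ⟩
      k * m + k                                    ≡⟨ ℕ.+-comm (k * m) k ⟩
      k + k * m                                    ≡⟨ ℕ.*-suc k m ⟨
      k * suc m                                    ∎)
      where open ℕ.≤-Reasoning

  -- Induction on `m`, peeling off one layer each time. The antichain is returned as a sublist so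
  -- that it inherits the order of `xs`. Of the chain only the first entry is located in `xs`, which
  -- is what the extension at the front needs.
  antichain-or-chain : ∀ k m (xs : List A) → suc (k * m) ≤ length xs →
    (∃[ ys ] ys ⊆ xs × length ys ≡ suc k × (∀ {x y} → x ∈ ys → y ∈ ys → ¬ R x y))
    ⊎ (∃[ y ] ∃[ ys ] y ∈ xs × Linked R (y ∷ ys) × length ys ≡ m)
  antichain-or-chain k zero    (x ∷ xs) _ = inj₂ (x , [] , here refl , [-] , refl)
  antichain-or-chain k zero    []       h rewrite ℕ.*-zeroʳ k with () ← h
  antichain-or-chain k (suc m) xs   large with suc k ≤? length (minimal xs)
  ... | yes many = inj₁
    ( take (suc k) (minimal xs)
    , ⊆-trans (take-⊆ (suc k) _) (filter-⊆ _ xs)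
    , trans (length-take (suc k) (minimal xs)) (ℕ.m≤n⇒m⊓n≡m many)
    , λ x∈ y∈ → minimal-antichain xs (⊆-lookup (take-⊆ (suc k) _) x∈) (⊆-lookup (take-⊆ (suc k) _) y∈) )
  ... | no few with antichain-or-chain k m (nonMinimal xs) (nonMinimal-large k m xs large few)
  ...   | inj₁ (ys , ys⊆ , rest) = inj₁ (ys , ⊆-trans ys⊆ (filter-⊆ _ xs) , rest)
  ...   | inj₂ (y , ys , y∈ , linked , len)
    -- The chain starts at a survivor `y`, so `y` has a predecessor `x` in `xs` to prepend.
    with x , x∈ , Rxy ← find (proj₂ (∈-filter⁻ (hasPred? xs) {xs = xs} y∈)) =
    inj₂ (x , y ∷ ys , x∈ , Rxy ∷ linked , cong suc len)

-- Upper bound: from lists of vertices to embeddings.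

increasing⇒unique : {xs : List (Fin n)} → Increasing xs → Unique xs
increasing⇒unique = AllPairs.map Fin.<⇒≢

-- The order of `H` is the length of the list, so `lookup` itself is the embedding. The list is
-- nonempty because a starting vertex must exist; here it is `zero`.
listEmbedding : {c : Coloring n} {j : Color} (x : Fin n) (xs : List (Fin n)) (H : Graph (length (x ∷ xs))) →
                Increasing (x ∷ xs) →
                (∀ {u v} → Adj H u v → color c (lookup (x ∷ xs) u) (lookup (x ∷ xs) v) ≡ j) →
                HasCyclicEmbedding H c j
listEmbedding x xs H inc col =
  record { φ = lookup (x ∷ xs) ; injective = lookup-injective (increasing⇒unique inc) ; colored = col } ,
  zero , subst Increasing (sym (trans (++-identityʳ _) (tabulate-lookup (x ∷ xs)))) inc

isColor₂? : (j : Color) → Dec (j ≡ color₂)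
isColor₂? color₁ = no λ ()
isColor₂? color₂ = yes refl

≢color₂⇒≡color₁ : ∀ {j} → j ≢ color₂ → j ≡ color₁
≢color₂⇒≡color₁ {color₁} _ = refl
≢color₂⇒≡color₁ {color₂} j≢ = contradiction refl j≢

module _ (c : Coloring n) where

  Arc₂ : Rel (Fin n) _
  Arc₂ u v = u Fin.< v × color c u v ≡ color₂

  Arc₂? : Decidable Arc₂
  Arc₂? u v = u <? v ×-dec isColor₂? (color c u v)

  no-Arc₂⇒color₁ : ∀ {u v} → u ≢ v → ¬ Arc₂ u v → ¬ Arc₂ v u → color c u v ≡ color₁
  no-Arc₂⇒color₁ {u} {v} u≢v ¬uv ¬vu with Fin.<-cmp u v
  ... | tri< u<v _ _ = ≢color₂⇒≡color₁ (λ e → ¬uv (u<v , e))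
  ... | tri≈ _ u≡v _ = contradiction u≡v u≢v
  ... | tri> _ _ v<u = ≢color₂⇒≡color₁ (λ e → ¬vu (v<u , trans (color-sym c v u) e))

  -- A clique contains every graph of its order: irreflexivity of `H` makes the ends of an edge
  -- distinct, and distinct entries are joined in color 1.
  cliqueEmbedding : (H : Graph (suc k)) (ys : List (Fin n)) → length ys ≡ suc k → Increasing ys →
                    (∀ {u v} → u ∈ ys → v ∈ ys → ¬ Arc₂ u v) → HasCyclicEmbedding H c color₁
  cliqueEmbedding H (y ∷ ys) refl inc anti = listEmbedding y ys H inc λ {u} {v} uv →
    no-Arc₂⇒color₁ (λ e → irrefl H (subst (Adj H u) (sym (lookup-injective (increasing⇒unique inc) e)) uv))
      (anti (∈-lookup u) (∈-lookup v)) (anti (∈-lookup v) (∈-lookup u))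

  pathEmbedding : (y : Fin n) (ys : List (Fin n)) → length ys ≡ m → Linked Arc₂ (y ∷ ys) →
                  HasCyclicEmbedding (Pmon (suc m)) c color₂
  pathEmbedding y ys refl linked =
    listEmbedding y ys (Pmon _) (Linked⇒AllPairs Fin.<-trans (Linked.map proj₁ linked)) λ where
      (fwd uv) → proj₂ (Linked-lookup linked uv)
      (bwd vu) → trans (color-sym c _ _) (proj₂ (Linked-lookup linked vu))

cyclicRamsey : ∀ k m (H : Graph (suc k)) → CyclicRamsey H (Pmon (suc m)) (suc (k * m))
cyclicRamsey k m H c
  with antichain-or-chain (Arc₂? c) k m (allFin _) (ℕ.≤-reflexive (sym (length-tabulate id)))
... | inj₁ (ys , ys⊆ , len , anti) =
  -- `ys` is increasing as a sublist of the increasing list `allFin`.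
  inj₁ (cliqueEmbedding c H ys len (AllPairs-resp-⊆ ys⊆ (tabulate⁺-< id)) anti)
... | inj₂ (y , ys , _ , linked , len) = inj₂ (pathEmbedding c y ys len linked)

-- Lower bound: edges of the cycle, quotients and the block coloring.

pathArc⇒Cmon-adj : ∀ {n} (2≤n : 2 ≤ n) {u v} → PathArc u v → Adj (Cmon n 2≤n) u v
pathArc⇒Cmon-adj {suc zero}          (s≤s ())
pathArc⇒Cmon-adj {suc (suc zero)}    _ e refl = ℕ.1+n≢n e
pathArc⇒Cmon-adj {suc (suc (suc _))} _ e = fwd (inj₁ e)

closingArc⇒Cmon-adj : ∀ {n} (2≤n : 2 ≤ n) {u v} → ClosingArc u v → Adj (Cmon n 2≤n) v u
closingArc⇒Cmon-adj {suc zero}          (s≤s ())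
closingArc⇒Cmon-adj {suc (suc zero)}    _ {zero} (_ , ()) refl
closingArc⇒Cmon-adj {suc (suc (suc _))} _ e = bwd (inj₂ e)

-- By contraposition: `combine` orders pairs lexicographically, so a larger quotient forces a larger
-- number.
quotient-mono-≤ : ∀ k m {u v : Fin (k * m)} → u Fin.< v → quotient {k} m u Fin.≤ quotient {k} m v
quotient-mono-≤ k m {u} {v} u<v = ℕ.≮⇒≥ λ q<q → Fin.<-asym u<v
  (subst₂ Fin._<_ (combine-remQuot {k} m v) (combine-remQuot {k} m u)
    (combine-monoˡ-< (remainder {k} m v) (remainder {k} m u) q<q))

quotient-remainder-injective : ∀ k m {u v : Fin (k * m)} → quotient {k} m u ≡ quotient {k} m v →
                               remainder {k} m u ≡ remainder {k} m v → u ≡ v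
quotient-remainder-injective k m {u} {v} q≡ r≡ =
  trans (sym (combine-remQuot {k} m u)) (trans (cong₂ combine q≡ r≡) (combine-remQuot {k} m v))

module _ (k m : ℕ) (n≤km : n ≤ k * m) where

  -- The vertices are taken as the first `n` of `k * m`, so one coloring refutes every `n` up to
  -- `k * m`, as minimality requires.
  block : Fin n → Fin k
  block u = quotient m (inject≤ u n≤km)

  block-mono-≤ : ∀ {u v} → u Fin.< v → block u Fin.≤ block v
  block-mono-≤ {u} {v} u<v = quotient-mono-≤ k m
    (subst₂ _<_ (sym (toℕ-inject≤ u n≤km)) (sym (toℕ-inject≤ v n≤km)) u<v)

  blockColor : Fin n → Fin n → Color
  blockColor u v = if does (block u ≟ block v) then color₂ else color₁

  blockColor-sym : ∀ u v → blockColor u v ≡ blockColor v u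
  blockColor-sym u v with block u ≟ block v | block v ≟ block u
  ... | yes _ | yes _ = refl
  ... | no  _ | no  _ = refl
  ... | yes e | no ¬e = contradiction (sym e) ¬e
  ... | no ¬e | yes e = contradiction (sym e) ¬e

  color₁⇒block-≢ : ∀ u v → blockColor u v ≡ color₁ → block u ≢ block v
  color₁⇒block-≢ u v e with block u ≟ block v
  color₁⇒block-≢ u v () | yes _
  ... | no b≢ = b≢

  color₂⇒block-≡ : ∀ u v → blockColor u v ≡ color₂ → block u ≡ block v
  color₂⇒block-≡ u v e with block u ≟ block v
  ... | yes b≡ = b≡
  color₂⇒block-≡ u v () | no _

  blockColoring : Coloring n
  blockColoring = record { color = blockColor ; color-sym = blockColor-sym }

  -- All `m + 1` vertices share one block, so their remainders would be distinct elements of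
  -- `Fin m`.
  no-path : ¬ Embedding (Pmon (suc m)) blockColoring color₂
  no-path f = ℕ.1+n≰n (injective⇒≤ {f = remainder {k} m ∘ (λ u → inject≤ u n≤km) ∘ φ} λ {u} {v} r≡ →
    injective (inject≤-injective n≤km n≤km _ _
      (quotient-remainder-injective k m (trans (sameBlock u) (sym (sameBlock v))) r≡)))
    where
    open Embedding f
    sameBlock : ∀ u → block (φ u) ≡ block (φ zero)
    sameBlock = <-weakInduction _ refl λ i ih →
      trans (sym (color₂⇒block-≡ _ _ (colored (fwd (cong suc (toℕ-inject₁ i)))))) ih

  -- Blocks rise weakly along the list and color 1 excludes equality of neighbors, so the blocks are
  -- distinct elements of `Fin k`.
  blocks-bound : {xs : List (Fin n)} → Increasing xs → Linked (λ u v → blockColor u v ≡ color₁) xs →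
                 length xs ≤ k
  blocks-bound {xs} inc col = subst (_≤ k) (length-map block xs)
    (injective⇒≤ (lookup-injective (increasing⇒unique (Linked⇒AllPairs Fin.<-trans
      (map⁺ (Linked.zipWith step (AllPairs⇒Linked inc , col)))))))
    where
    step : ∀ {u v} → u Fin.< v × blockColor u v ≡ color₁ → block u Fin.< block v
    step {u} {v} (u<v , e) = Fin.≤∧≢⇒< (block-mono-≤ u<v) (color₁⇒block-≢ u v e)

  no-cycle : (2≤a : 2 ≤ suc k) → ¬ HasCyclicEmbedding (Cmon (suc k) 2≤a) blockColoring color₁
  no-cycle 2≤a (f , t , inc) = ℕ.1+n≰n (subst (_≤ k) len (blocks-bound inc linked))
    where
    open Embedding f
    R₁ : Rel (Fin n) _
    R₁ u v = blockColor u v ≡ color₁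

    before after : List (Fin n)
    before = take (toℕ t) (tabulate φ)
    after  = drop (toℕ t) (tabulate φ)

    split : before ++ after ≡ tabulate φ
    split = take++drop≡id (toℕ t) (tabulate φ)

    len : length (after ++ before) ≡ suc k
    len = trans (length-++-comm after before) (trans (cong length split) (length-tabulate φ))

    closing : Connected R₁ (last (tabulate φ)) (head (tabulate φ))
    closing = subst (λ z → Connected R₁ z (just (φ zero))) (sym (last-tabulate φ))
      (just (colored (closingArc⇒Cmon-adj 2≤a (refl , cong suc (toℕ-fromℕ k)))))

    -- The rotation opens the cycle just before `t` and uses the closing edge, from the last vertex
    -- to vertex 0, to join the two pieces.
    linked : Linked R₁ (after ++ before)
    linked = Linked-++-swap before after
      (subst (Linked R₁) (sym split) (Linked-tabulate⁺ φ (colored ∘ pathArc⇒Cmon-adj 2≤a)))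
      (subst (λ zs → Connected R₁ (last zs) (head zs)) (sym split) closing)

  not-cyclicRamsey : (2≤a : 2 ≤ suc k) → ¬ CyclicRamsey (Cmon (suc k) 2≤a) (Pmon (suc m)) n
  not-cyclicRamsey 2≤a ramsey with ramsey blockColoring
  ... | inj₁ cycle      = no-cycle 2≤a cycle
  ... | inj₂ (path , _) = no-path path

theorem4p12 : (a b : ℕ) (2≤a : 2 ≤ a) → 1 ≤ b → IsRcyc (Cmon a 2≤a) (Pmon b) (1 + (a ∸ 1) * (b ∸ 1))
theorem4p12 (suc k) (suc m) 2≤a _ =
  cyclicRamsey k m (Cmon (suc k) 2≤a) ,
  λ n ramsey → ℕ.≰⇒> λ n≤km → not-cyclicRamsey k m n≤km 2≤a ramsey
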